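{- Let $k\in\mathbb{Z}$, let $n\ge 0$ be an integer, and let $\lambda\in\mathbb{C}$ be nonzero. Then $$\beta_{n,\lambda}^{(k)}=\sum_{l=0}^{n}\sum_{m=0}^{l}\frac{(-1)^{m+l}\,m!}{(m+1)^{k}}S_{2}(l,m)S_{1}(n,l)\lambda^{n-l}.$$
   Context: For $k\in\mathbb{Z}$, $\mathrm{Li}_k(u)=\sum_{n=1}^{\infty}\frac{u^n}{n^k}$. For nonzero $\lambda$, the fully degenerate poly-Bernoulli numbers $\beta_{n,\lambda}^{(k)}$ are defined by the generating function (identity of formal power series in $t$) $$\frac{\mathrm{Li}_{k}\left(1-(1+\lambda t)^{ -1/\lambda}\right)}{1-(1+\lambda t)^{ -1/\lambda}}=\sum_{n=0}^{\infty}\beta_{n,\lambda}^{(k)}\frac{t^{n}}{n!},$$ where $(1+\lambda t)^{a}=\sum_{j\ge0}(a)_j\lambda^j\frac{t^j}{j!}$, $(a)_j=a(a-1)\cdots(a-j+1)$ with $(a)_0=1$, and $\mathrm{Li}_k(u)/u$ denotes the series $\sum_{m\ge 0}u^m/(m+1)^k$. $S_1(n,l)$ denotes the (signed) Stirling numbers of the first kind, $(x)_n=\sum_{l=0}^n S_1(n,l)x^l$, and $S_2(n,l)$ the Stirling numbers of the second kind, $\frac{(e^t-1)^l}{l!}=\sum_{n\ge l}S_2(n,l)\frac{t^n}{n!}$. -}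

module Defs where

open import Algebra.Apartness.Bundles using (HeytingField; HeytingCommutativeRing)
open import Algebra.Bundles using (CommutativeRing)
open import Algebra.Bundles.Raw using (RawRing)
import Algebra.Definitions.RawSemiring as RawSemiringDefs
import Algebra.Properties.Semiring.Exp as SemiringExp
import Algebra.Properties.Semiring.Mult as SemiringMult
import Algebra.Properties.Semiring.Sum as SemiringSum
import Algebra.Apartness.Properties.HeytingCommutativeRing as HCRProperties
open import Data.Fin.Base using (toℕ)
open import Data.Integer.Base as ℤ using (ℤ; +_; -[1+_])
open import Data.Nat.Base using (ℕ; zero; suc; _∸_; _!; NonZero)
open import Data.Nat.Properties using (_!≢0)
open import Data.Product.Base using (proj₁; proj₂)
import Relation.Binary.Reasoning.Setoid as SetoidReasoning

module FallingFactorial {c ℓ} (R : RawRing c ℓ) where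
  open RawRing R
  open RawSemiringDefs rawSemiring using (_×_)

  -- x (x - 1) ⋯ (x - n + 1)
  falling : Carrier → ℕ → Carrier
  falling x zero    = 1#
  falling x (suc n) = falling x n * (x + - (n × 1#))

-- R[[t]]; a series is its sequence of coefficients.
powerSeries : ∀ {c ℓ} → RawRing c ℓ → RawRing c ℓ
powerSeries R = record
  { Carrier = ℕ → Carrier
  ; _≈_     = λ f g → ∀ n → f n ≈ g n
  ; _+_     = λ f g n → f n + g n
  ; _*_     = λ f g n → sum {suc n} (λ i → f (toℕ i) * g (n ∸ toℕ i))
  ; -_      = λ f n → - f n
  ; 0#      = λ _ → 0#
  ; 1#      = λ { zero → 1# ; (suc _) → 0# }
  }
  where
  open RawRing R
  open RawSemiringDefs rawSemiring using (sum)

-- The only structure of ℂ involved in the degenerate poly-Bernoulli numbers is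
-- that of a field of characteristic zero; constructively ℂ is a Heyting field,
-- and being nonzero means being apart from zero.
CharacteristicZero : ∀ {c ℓ₁ ℓ₂} → HeytingField c ℓ₁ ℓ₂ → Set ℓ₂
CharacteristicZero K = ∀ n .{{_ : NonZero n}} → (n × 1#) # 0#
  where
  open HeytingField K
  open HeytingCommutativeRing heytingCommutativeRing using (commutativeRing)
  open CommutativeRing commutativeRing using (semiring)
  open SemiringMult semiring using (_×_)

module PolyBernoulli {c ℓ₁ ℓ₂} (K : HeytingField c ℓ₁ ℓ₂)
                     (char0 : CharacteristicZero K) where

  open HeytingField K
  open HeytingCommutativeRing heytingCommutativeRing public using (commutativeRing)
  open CommutativeRing commutativeRing public using (rawRing; semiring)
  open SemiringMult semiring public using (_×_)
  open SemiringExp semiring public using (_^_)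
  open SemiringSum semiring public using (sum; sum-syntax; sum⁺-syntax)
  open FallingFactorial rawRing public using (falling)

  Series : RawRing c ℓ₁
  Series = powerSeries rawRing

  module S = RawRing Series
  open RawSemiringDefs S.rawSemiring public using () renaming (_^_ to _^ˢ_)
  open FallingFactorial Series public using () renaming (falling to fallingˢ)

  fromℕ : ℕ → Carrier
  fromℕ n = n × 1#

  inv : ∀ {x} → x # 0# → Carrier
  inv x#0 = proj₁ (#⇒invertible x#0)

  powℤ : ∀ x → x # 0# → ℤ → Carrier
  powℤ x x#0 (+ n)    = x ^ n
  powℤ x x#0 -[1+ n ] = inv x#0 ^ suc n

  -- 1 / (m + 1)ᵏ
  recipPow : ℕ → ℤ → Carrier
  recipPow m k = powℤ (fromℕ (suc m)) (char0 (suc m)) (ℤ.- k)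

  inv! : ℕ → Carrier
  inv! n = inv (char0 (n !) {{n !≢0}})

  -- Σₙ aₙ tⁿ / n!, and the recovery of the aₙ from such a series
  egf : (ℕ → Carrier) → S.Carrier
  egf a n = a n * inv! n

  egfCoeff : S.Carrier → ℕ → Carrier
  egfCoeff f n = fromℕ (n !) * f n

  _•_ : Carrier → S.Carrier → S.Carrier
  (a • f) n = a * f n

  -- Σₘ fₘ gᵐ. The truncation at m = n is exact only for g with zero
  -- constant term, in which case [tⁿ] gᵐ vanishes for m > n.
  _⟨_⟩ : S.Carrier → S.Carrier → S.Carrier
  (f ⟨ g ⟩) n = ∑[ m ≤ n ] (f (toℕ m) * (g ^ˢ toℕ m) n)

  X : S.Carrier
  X 1 = 1#
  X _ = 0#

  exp : S.Carrier
  exp = egf (λ _ → 1#)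

  -- (1 + l t)ᵃ
  binomialSeries : Carrier → Carrier → S.Carrier
  binomialSeries l a = egf (λ j → falling a j * l ^ j)

  -- Signed Stirling numbers of the first kind: the coefficient of xˡ in the
  -- polynomial (x)ₙ, the latter computed in K[[x]] ⊇ K[x].
  S₁ : ℕ → ℕ → Carrier
  S₁ n l = fallingˢ X n l

  S₂ : ℕ → ℕ → Carrier
  S₂ n l = egfCoeff (inv! l • ((exp S.+ S.- S.1#) ^ˢ l)) n

  -- Liₖ(u) / u
  polylogQuotient : ℤ → S.Carrier
  polylogQuotient k m = recipPow m k

  module _ (l : Carrier) (l#0 : l # 0#) where

    -- 1 - (1 + l t)^(-1/l)
    argument : S.Carrier
    argument = S.1# S.+ S.- binomialSeries l (- inv l#0)

    generatingFunction : ℤ → S.Carrier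
    generatingFunction k = polylogQuotient k ⟨ argument ⟩

    β : ℤ → ℕ → Carrier
    β k = egfCoeff (generatingFunction k)

  private
    open SetoidReasoning setoid
    open HCRProperties heytingCommutativeRing using (x-0≈x)

    inv-inverseʳ : ∀ {x} (x#0 : x # 0#) → x * inv x#0 ≈ 1#
    inv-inverseʳ {x} x#0 = begin
      x * inv x#0         ≈⟨ *-congʳ (x-0≈x x) ⟨
      (x - 0#) * inv x#0  ≈⟨ proj₂ (proj₂ (#⇒invertible x#0)) ⟩
      1#                  ∎

  argument-constantTerm : ∀ l (l#0 : l # 0#) → argument l l#0 0 ≈ 0#
  argument-constantTerm l l#0 = begin
    1# - 1# * 1# * inv! 0  ≈⟨ +-congˡ (-‿cong lemma) ⟩
    1# - 1#                ≈⟨ -‿inverseʳ 1# ⟩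
    0#                     ∎
    where
    lemma : 1# * 1# * inv! 0 ≈ 1#
    lemma = begin
      1# * 1# * inv! 0    ≈⟨ *-congʳ (*-identityˡ 1#) ⟩
      1# * inv! 0         ≈⟨ *-congʳ (+-identityʳ 1#) ⟨
      (1# + 0#) * inv! 0  ≈⟨ inv-inverseʳ (char0 (0 !) {{0 !≢0}}) ⟩
      1#                  ∎

  -- The identity defining the numbers β.
  β-generatingFunction : ∀ l (l#0 : l # 0#) k n →
                         generatingFunction l l#0 k n ≈ egf (β l l#0 k) n
  β-generatingFunction l l#0 k n = begin
    f                              ≈⟨ *-identityˡ f ⟨
    1# * f                         ≈⟨ *-congʳ (inv-inverseʳ n!#0) ⟨
    fromℕ (n !) * inv! n * f       ≈⟨ *-assoc _ _ _ ⟩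
    fromℕ (n !) * (inv! n * f)     ≈⟨ *-congˡ (*-comm _ _) ⟩
    fromℕ (n !) * (f * inv! n)     ≈⟨ *-assoc _ _ _ ⟨
    fromℕ (n !) * f * inv! n       ∎
    where
    f    = generatingFunction l l#0 k n
    n!#0 = char0 (n !) {{n !≢0}}

module Submission where

open import Defs
open import Algebra.Apartness.Bundles using (HeytingField; HeytingCommutativeRing)
open import Algebra.Bundles using (CommutativeRing)
import Algebra.Apartness.Properties.HeytingCommutativeRing as HCRProperties
import Algebra.Definitions.RawSemiring as RawSemiringDefs
import Algebra.Properties.Ring as RingProperties
import Algebra.Properties.Semiring.Mult as SemiringMult
import Algebra.Properties.Semiring.Sum as SemiringSum
import Algebra.Solver.Ring.NaturalCoefficients.Default as NaturalCoefficients
open import Data.Fin.Base using (toℕ)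
open import Data.Fin.Properties using (toℕ≤pred[n])
open import Data.Integer.Base using (ℤ)
open import Data.Nat.Base as ℕ using (ℕ; zero; suc; _∸_; _!; _≤_; _<_; z≤n; s≤s; z<s; s<s)
open import Data.Nat.Properties as ℕ using (_!≢0; _<?_; ≮⇒≥; m<n⇒m<1+n; m+[n∸m]≡n; +-suc)
open import Data.Product.Base using (proj₂)
open import Function.Base using (_∘_)
open import Relation.Binary.PropositionalEquality.Core as ≡ using ()
import Relation.Binary.Reasoning.Setoid as SetoidReasoning
open import Relation.Nullary.Decidable.Core using (yes; no)

-- All powers f^m of a series with f(0) = 0 and (1 + l t) f' = 1 + c f are
-- pinned down by the differential equation: n! [tⁿ] f^m satisfies a recurrence
-- in m and n with fixed boundary values. This applies to eᵗ - 1 (l = 0, c = 1)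
-- and to 1 - (1 + l t)^(-1/l) (c = -1). The recurrence of S₁ shows that the
-- substitution t ↦ -log(1 + l t)/l, written on coefficients as
-- (aⱼ)ⱼ ↦ (Σⱼ (-1)ʲ S₁(n,j) l^(n-j) aⱼ)ₙ, turns a solution for (0 , 1) into (-1)ᵐ times
-- one for (l , -1). Hence n! [tⁿ] (1 - (1 + l t)^(-1/l))^m is a combination of the
-- m! S₂(j,m).

module DegeneratePowers {c ℓ₁ ℓ₂} (K : HeytingField c ℓ₁ ℓ₂)
                        (char0 : CharacteristicZero K) where

  open HeytingField K
  open PolyBernoulli K char0
  open CommutativeRing commutativeRing using (ring; commutativeSemiring)
  open HCRProperties heytingCommutativeRing using (x-0≈x)
  open RingProperties ring
    using (-0#≈0#; -1*x≈-x; -‿distribˡ-*; -‿+-comm; -‿involutive; +-cancelʳ)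
  open SemiringMult semiring using (×1-homo-*; ×-homo-+)
  open SemiringSum semiring
    using (sum-cong-≋; ∑-distrib-+; ∑-comm; *-distribˡ-sum; sum-replicate-zero)
  open RawSemiringDefs S.rawSemiring using () renaming (_×_ to _×ˢ_)
  open NaturalCoefficients commutativeSemiring using (solve; _:+_; _:*_; _:=_)
  open SetoidReasoning setoid

  -- Inverse factorials and finite sums

  inv-inverseʳ : ∀ {x} (x#0 : x # 0#) → x * inv x#0 ≈ 1#
  inv-inverseʳ {x} x#0 =
    -- Invertibility is provided for the difference `x - 0#`, hence the rewriting by `x-0≈x`.
    trans (*-congʳ (sym (x-0≈x x))) (proj₂ (proj₂ (#⇒invertible x#0)))

  inv!-inverseʳ : ∀ n → fromℕ (n !) * inv! n ≈ 1#
  inv!-inverseʳ n = inv-inverseʳ (char0 (n !) {{n !≢0}})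

  fromℕ-suc! : ∀ n → fromℕ (suc n !) ≈ fromℕ (suc n) * fromℕ (n !)
  fromℕ-suc! n = ×1-homo-* (suc n) (n !)

  inv!-suc : ∀ n → fromℕ (suc n) * inv! (suc n) ≈ inv! n
  inv!-suc n = begin
    s * j                ≈⟨ *-identityʳ _ ⟨
    s * j * 1#           ≈⟨ *-congˡ (inv!-inverseʳ n) ⟨
    s * j * (f * i)      ≈⟨ solve 4 (λ s j f i → (s :* j) :* (f :* i) := ((s :* f) :* j) :* i) refl s j f i ⟩
    s * f * j * i        ≈⟨ *-congʳ (*-congʳ (fromℕ-suc! n)) ⟨
    fromℕ (suc n !) * j * i ≈⟨ *-congʳ (inv!-inverseʳ (suc n)) ⟩
    1# * i               ≈⟨ *-identityˡ i ⟩
    i                    ∎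
    where
    s = fromℕ (suc n)
    f = fromℕ (n !)
    i = inv! n
    j = inv! (suc n)

  inv!-zero : inv! 0 ≈ 1#
  inv!-zero = begin
    inv! 0               ≈⟨ *-identityˡ _ ⟨
    1# * inv! 0          ≈⟨ *-congʳ (+-identityʳ 1#) ⟨
    fromℕ (0 !) * inv! 0 ≈⟨ inv!-inverseʳ 0 ⟩
    1#                   ∎

  sum-zero : ∀ {n} {f : ℕ → Carrier} → (∀ i → f i ≈ 0#) → ∑[ i < n ] f (toℕ i) ≈ 0#
  sum-zero {n} f≈0 = trans (sum-cong-≋ {n} (λ i → f≈0 (toℕ i))) (sum-replicate-zero n)

  -- Brings sums over different ranges to a common bound. Both sums start at 0, so the induction
  -- peels off equal first summands and shifts `f`.
  sum-extend : ∀ {m n} {f : ℕ → Carrier} → m ≤ n → (∀ i → m < i → f i ≈ 0#) →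
               ∑[ i ≤ m ] f (toℕ i) ≈ ∑[ i ≤ n ] f (toℕ i)
  sum-extend {n = n} z≤n f≈0 = +-congˡ (sym (sum-zero {n} (λ i → f≈0 (suc i) z<s)))
  sum-extend (s≤s m≤n) f≈0   = +-congˡ (sum-extend m≤n (λ i m<i → f≈0 (suc i) (s<s m<i)))

  -- Products, derivations and powers of series

  *ˢ-cong : ∀ {f f′ g g′} → f S.≈ f′ → g S.≈ g′ → (f S.* g) S.≈ (f′ S.* g′)
  *ˢ-cong f≈f′ g≈g′ n =
    sum-cong-≋ {suc n} (λ i → *-cong (f≈f′ (toℕ i)) (g≈g′ (n ∸ toℕ i)))

  *ˢ-distribˡ-+ : ∀ f g h → (f S.* (g S.+ h)) S.≈ ((f S.* g) S.+ (f S.* h))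
  *ˢ-distribˡ-+ f g h n = trans
    (sum-cong-≋ {suc n} (λ i → distribˡ (f (toℕ i)) (g (n ∸ toℕ i)) (h (n ∸ toℕ i))))
    (∑-distrib-+ {suc n} (λ i → f (toℕ i) * g (n ∸ toℕ i)) (λ i → f (toℕ i) * h (n ∸ toℕ i)))

  *ˢ-distribʳ-+ : ∀ f g h → ((g S.+ h) S.* f) S.≈ ((g S.* f) S.+ (h S.* f))
  *ˢ-distribʳ-+ f g h n = trans
    (sum-cong-≋ {suc n} (λ i → distribʳ (f (n ∸ toℕ i)) (g (toℕ i)) (h (toℕ i))))
    (∑-distrib-+ {suc n} (λ i → g (toℕ i) * f (n ∸ toℕ i)) (λ i → h (toℕ i) * f (n ∸ toℕ i)))

  •-*ˢ : ∀ a f g → ((a • f) S.* g) S.≈ (a • (f S.* g))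
  •-*ˢ a f g n = trans
    (sum-cong-≋ {suc n} (λ i → *-assoc a (f (toℕ i)) (g (n ∸ toℕ i))))
    (sym (*-distribˡ-sum {suc n} a (λ i → f (toℕ i) * g (n ∸ toℕ i))))

  *ˢ-• : ∀ a f g → (f S.* (a • g)) S.≈ (a • (f S.* g))
  *ˢ-• a f g n = trans
    (sum-cong-≋ {suc n} (λ i →
      solve 3 (λ a x y → x :* (a :* y) := a :* (x :* y)) refl a (f (toℕ i)) (g (n ∸ toℕ i))))
    (sym (*-distribˡ-sum {suc n} a (λ i → f (toℕ i) * g (n ∸ toℕ i))))

  *ˢ-zeroʳ : ∀ f {z} → z S.≈ S.0# → (f S.* z) S.≈ S.0#
  *ˢ-zeroʳ f {z} z≈0 n = trans
    (sum-cong-≋ {suc n} (λ i → trans (*-congˡ (z≈0 (n ∸ toℕ i))) (zeroʳ (f (toℕ i)))))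
    (sum-replicate-zero (suc n))

  *ˢ-identityˡ : ∀ f → (S.1# S.* f) S.≈ f
  *ˢ-identityˡ f n = begin
    1# * f n + ∑[ i < n ] (0# * f (n ∸ suc (toℕ i)))
      ≈⟨ +-cong (*-identityˡ (f n)) (sum-zero {n} (λ i → zeroˡ (f (n ∸ suc i)))) ⟩
    f n + 0#
      ≈⟨ +-identityʳ (f n) ⟩
    f n ∎

  -- By definition, `(f S.* g) (suc n)` is `f 0 * g (suc n)` plus `((f ∘ suc) S.* g) n`. The
  -- induction shifts `f` along this unfolding, as do the two other inductions on products below.
  *ˢ-constantʳ : ∀ f g → (∀ n → g (suc n) ≈ 0#) → ∀ n → (f S.* g) n ≈ f n * g 0
  *ˢ-constantʳ f g g≈0 zero    = +-identityʳ _
  *ˢ-constantʳ f g g≈0 (suc n) = begin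
    f 0 * g (suc n) + ((f ∘ suc) S.* g) n
      ≈⟨ +-cong (trans (*-congˡ (g≈0 n)) (zeroʳ (f 0))) (*ˢ-constantʳ (f ∘ suc) g g≈0 n) ⟩
    0# + f (suc n) * g 0
      ≈⟨ +-identityˡ _ ⟩
    f (suc n) * g 0 ∎

  *ˢ-X-suc : ∀ f n → (f S.* X) (suc n) ≈ f n
  *ˢ-X-suc f zero = begin
    f 0 * 1# + (f 1 * 0# + 0#) ≈⟨ +-cong (*-identityʳ (f 0)) (trans (+-identityʳ _) (zeroʳ (f 1))) ⟩
    f 0 + 0#                   ≈⟨ +-identityʳ (f 0) ⟩
    f 0                        ∎
  *ˢ-X-suc f (suc n) = begin
    f 0 * 0# + ((f ∘ suc) S.* X) (suc n) ≈⟨ +-cong (zeroʳ (f 0)) (*ˢ-X-suc (f ∘ suc) n) ⟩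
    0# + f (suc n)                       ≈⟨ +-identityˡ _ ⟩
    f (suc n)                            ∎

  D : S.Carrier → S.Carrier
  D f n = fromℕ (suc n) * f (suc n)

  -- t d/dt
  θ : S.Carrier → S.Carrier
  θ f n = fromℕ n * f n

  -- (1 + l t) d/dt
  ∂ : Carrier → S.Carrier → S.Carrier
  ∂ l f = D f S.+ (l • θ f)

  -- The weight `n` of each summand splits as `i + (n ∸ i)`, one part for each factor. Since `θ`
  -- keeps degrees, no index moves.
  θ-*ˢ : ∀ f g → θ (f S.* g) S.≈ ((θ f S.* g) S.+ (f S.* θ g))
  θ-*ˢ f g n = begin
    fromℕ n * ∑[ i ≤ n ] (f (toℕ i) * g (n ∸ toℕ i))
      ≈⟨ *-distribˡ-sum {suc n} (fromℕ n) (λ i → f (toℕ i) * g (n ∸ toℕ i)) ⟩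
    ∑[ i ≤ n ] (fromℕ n * (f (toℕ i) * g (n ∸ toℕ i)))
      ≈⟨ sum-cong-≋ {suc n} (λ i → term (toℕ i) (toℕ≤pred[n] i)) ⟩
    ∑[ i ≤ n ] (θ f (toℕ i) * g (n ∸ toℕ i) + f (toℕ i) * θ g (n ∸ toℕ i))
      ≈⟨ ∑-distrib-+ {suc n} (λ i → θ f (toℕ i) * g (n ∸ toℕ i)) (λ i → f (toℕ i) * θ g (n ∸ toℕ i)) ⟩
    (θ f S.* g) n + (f S.* θ g) n ∎
    where
    term : ∀ i → i ≤ n → fromℕ n * (f i * g (n ∸ i)) ≈ θ f i * g (n ∸ i) + f i * θ g (n ∸ i)
    term i i≤n = begin
      fromℕ n * (f i * g (n ∸ i))
        ≡⟨ ≡.cong (λ k → fromℕ k * (f i * g (n ∸ i))) (m+[n∸m]≡n i≤n) ⟨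
      fromℕ (i ℕ.+ (n ∸ i)) * (f i * g (n ∸ i))
        ≈⟨ *-congʳ (×-homo-+ 1# i (n ∸ i)) ⟩
      (fromℕ i + fromℕ (n ∸ i)) * (f i * g (n ∸ i))
        ≈⟨ solve 4 (λ p q x y → (p :+ q) :* (x :* y) := ((p :* x) :* y) :+ (x :* (q :* y))) refl
             (fromℕ i) (fromℕ (n ∸ i)) (f i) (g (n ∸ i)) ⟩
      θ f i * g (n ∸ i) + f i * θ g (n ∸ i) ∎

  θ-constantTerm : ∀ f x → θ f 0 * x ≈ 0#
  θ-constantTerm f x = trans (*-congʳ (zeroˡ (f 0))) (zeroˡ x)

  -- `θ g` is t times `D g`; the one additional summand on the left contains `θ g 0` and vanishes.
  *ˢ-θ-suc : ∀ f g n → (f S.* θ g) (suc n) ≈ (f S.* D g) n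
  *ˢ-θ-suc f g zero    = +-congˡ (trans (+-identityʳ _) (trans (*-comm _ _) (θ-constantTerm g (f 1))))
  *ˢ-θ-suc f g (suc n) = +-congˡ (*ˢ-θ-suc (f ∘ suc) g n)

  -- `D f n` is `θ f (suc n)` by definition, so this is `θ-*ˢ` one degree higher, without the
  -- boundary summands that contain `θ f 0` or `θ g 0`.
  D-*ˢ : ∀ f g → D (f S.* g) S.≈ ((D f S.* g) S.+ (f S.* D g))
  D-*ˢ f g n = begin
    θ (f S.* g) (suc n)
      ≈⟨ θ-*ˢ f g (suc n) ⟩
    (θ f 0 * g (suc n) + (D f S.* g) n) + (f S.* θ g) (suc n)
      ≈⟨ +-cong (+-congʳ (θ-constantTerm f (g (suc n)))) (*ˢ-θ-suc f g n) ⟩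
    (0# + (D f S.* g) n) + (f S.* D g) n
      ≈⟨ +-congʳ (+-identityˡ _) ⟩
    (D f S.* g) n + (f S.* D g) n ∎

  ∂-*ˢ : ∀ l f g → ∂ l (f S.* g) S.≈ ((∂ l f S.* g) S.+ (f S.* ∂ l g))
  ∂-*ˢ l f g n = begin
    D (f S.* g) n + l * θ (f S.* g) n
      ≈⟨ +-cong (D-*ˢ f g n) (*-congˡ (θ-*ˢ f g n)) ⟩
    ((D f S.* g) n + (f S.* D g) n) + l * ((θ f S.* g) n + (f S.* θ g) n)
      ≈⟨ solve 5 (λ p q l r s → (p :+ q) :+ (l :* (r :+ s)) := (p :+ (l :* r)) :+ (q :+ (l :* s))) refl
           ((D f S.* g) n) ((f S.* D g) n) l ((θ f S.* g) n) ((f S.* θ g) n) ⟩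
    ((D f S.* g) n + l * (θ f S.* g) n) + ((f S.* D g) n + l * (f S.* θ g) n)
      ≈⟨ +-cong (+-congˡ (•-*ˢ l (θ f) g n)) (+-congˡ (*ˢ-• l f (θ g) n)) ⟨
    ((D f S.* g) n + ((l • θ f) S.* g) n) + ((f S.* D g) n + (f S.* (l • θ g)) n)
      ≈⟨ +-cong (*ˢ-distribʳ-+ g (D f) (l • θ f) n) (*ˢ-distribˡ-+ f (D g) (l • θ g) n) ⟨
    (∂ l f S.* g) n + (f S.* ∂ l g) n ∎

  ∂-1 : ∀ l → ∂ l S.1# S.≈ S.0#
  ∂-1 l n = begin
    fromℕ (suc n) * 0# + l * θ S.1# n ≈⟨ +-cong (zeroʳ _) (trans (*-congˡ (θ-1 n)) (zeroʳ l)) ⟩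
    0# + 0#                           ≈⟨ +-identityˡ 0# ⟩
    0#                                ∎
    where
    θ-1 : ∀ n → θ S.1# n ≈ 0#
    θ-1 zero    = zeroˡ 1#
    θ-1 (suc n) = zeroʳ _

  ∂-difference : ∀ l f g → ∂ l (f S.+ (S.- g)) S.≈ (∂ l f S.+ (S.- ∂ l g))
  ∂-difference l f g n = begin
    p * (x + - y) + l * (q * (u + - v))
      -- Each minus sign becomes a factor `e`, which the semiring solver treats as a variable.
      ≈⟨ +-cong (*-congˡ (+-congˡ (-1*x≈-x y))) (*-congˡ (*-congˡ (+-congˡ (-1*x≈-x v)))) ⟨
    p * (x + e * y) + l * (q * (u + e * v))
      ≈⟨ solve 8 (λ p x e y l q u v →
           (p :* (x :+ e :* y)) :+ (l :* (q :* (u :+ e :* v)))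
             := ((p :* x) :+ (l :* (q :* u))) :+ (e :* ((p :* y) :+ (l :* (q :* v))))) refl
           p x e y l q u v ⟩
    ∂ l f n + e * ∂ l g n
      ≈⟨ +-congˡ (-1*x≈-x _) ⟩
    ∂ l f n + - ∂ l g n ∎
    where
    e = - 1#
    p = fromℕ (suc n)
    q = fromℕ n
    x = f (suc n)
    y = g (suc n)
    u = f n
    v = g n

  -- The power rule, with the equation for `∂ l g` inserted. The Leibniz rule for g times gᵐ yields
  -- one copy of `h m` from the first factor and m copies from the second.
  ∂-^ˢ : ∀ {l c g} → ∂ l g S.≈ (S.1# S.+ (c • g)) → ∀ m →
         ∂ l (g ^ˢ suc m) S.≈ (fromℕ (suc m) • ((g ^ˢ m) S.+ (c • (g ^ˢ suc m))))
  ∂-^ˢ {l} {c} {g} ∂g m n = begin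
    ∂ l (g S.* (g ^ˢ m)) n                               ≈⟨ ∂-*ˢ l g (g ^ˢ m) n ⟩
    (∂ l g S.* (g ^ˢ m)) n + (g S.* ∂ l (g ^ˢ m)) n      ≈⟨ +-cong left (right m) ⟩
    h m + fromℕ m * h m                                  ≈⟨ +-congʳ (*-identityˡ (h m)) ⟨
    1# * h m + fromℕ m * h m                             ≈⟨ distribʳ (h m) 1# (fromℕ m) ⟨
    fromℕ (suc m) * h m                                  ∎
    where
    h : ℕ → Carrier
    h m = (g ^ˢ m) n + c * (g ^ˢ suc m) n

    left : (∂ l g S.* (g ^ˢ m)) n ≈ h m
    left = begin
      (∂ l g S.* (g ^ˢ m)) n
        ≈⟨ *ˢ-cong {g = g ^ˢ m} ∂g (λ _ → refl) n ⟩
      ((S.1# S.+ (c • g)) S.* (g ^ˢ m)) n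
        ≈⟨ *ˢ-distribʳ-+ (g ^ˢ m) S.1# (c • g) n ⟩
      (S.1# S.* (g ^ˢ m)) n + ((c • g) S.* (g ^ˢ m)) n
        ≈⟨ +-cong (*ˢ-identityˡ (g ^ˢ m) n) (•-*ˢ c g (g ^ˢ m) n) ⟩
      h m ∎

    -- Multiplying the induction hypothesis for the smaller power by `g` raises each exponent by one
    -- and so produces `h` at the next index.
    right : ∀ m → (g S.* ∂ l (g ^ˢ m)) n ≈ fromℕ m * h m
    right zero    = trans (*ˢ-zeroʳ g (∂-1 l) n) (sym (zeroˡ _))
    right (suc m) = begin
      (g S.* ∂ l (g ^ˢ suc m)) n
        ≈⟨ *ˢ-cong {f = g} (λ _ → refl) (∂-^ˢ ∂g m) n ⟩
      (g S.* (fromℕ (suc m) • ((g ^ˢ m) S.+ (c • (g ^ˢ suc m))))) n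
        ≈⟨ *ˢ-• (fromℕ (suc m)) g ((g ^ˢ m) S.+ (c • (g ^ˢ suc m))) n ⟩
      fromℕ (suc m) * (g S.* ((g ^ˢ m) S.+ (c • (g ^ˢ suc m)))) n
        ≈⟨ *-congˡ (*ˢ-distribˡ-+ g (g ^ˢ m) (c • (g ^ˢ suc m)) n) ⟩
      fromℕ (suc m) * ((g ^ˢ suc m) n + (g S.* (c • (g ^ˢ suc m))) n)
        ≈⟨ *-congˡ (+-congˡ (*ˢ-• c g (g ^ˢ suc m) n)) ⟩
      fromℕ (suc m) * h (suc m) ∎

  -- Recurrences for the coefficients of powers

  egfCoeff-∂ : ∀ l f n → egfCoeff f (suc n) + l * fromℕ n * egfCoeff f n ≈ fromℕ (n !) * ∂ l f n
  -- In n! ((n + 1) f(n + 1) + l n f(n)) the factor n + 1 joins the factorial; the outcome is the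
  -- left-hand side of `suc-suc`.
  egfCoeff-∂ l f n = trans (+-congʳ (*-congʳ (fromℕ-suc! n)))
    (solve 6 (λ s F x l N y →
       ((s :* F) :* x) :+ ((l :* N) :* (F :* y)) := F :* ((s :* x) :+ (l :* (N :* y)))) refl
       (fromℕ (suc n)) (fromℕ (n !)) (f (suc n)) l (fromℕ n) (f n))

  -- The numbers n! [tⁿ] f^m for f(0) = 0 and (1 + l t) f' = 1 + c f.
  record PowerCoefficients (l c : Carrier) (a : ℕ → ℕ → Carrier) : Set ℓ₁ where
    field
      zero-zero : a 0 0 ≈ 1#
      zero-suc  : ∀ n → a 0 (suc n) ≈ 0#
      suc-zero  : ∀ m → a (suc m) 0 ≈ 0#
      suc-suc   : ∀ m n → a (suc m) (suc n) + l * fromℕ n * a (suc m) n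
                          ≈ fromℕ (suc m) * (a m n + c * a (suc m) n)

  open PowerCoefficients

  -- Induction on `n` for all `m` at once: `suc-suc` determines the entries at `suc n` from those at
  -- `n`. To cancel the correction term it must be the same on both sides, so the hypothesis also
  -- exchanges `b` for `a` there.
  PowerCoefficients-unique : ∀ {l c a b} → PowerCoefficients l c a → PowerCoefficients l c b →
                             ∀ m n → a m n ≈ b m n
  PowerCoefficients-unique A B zero    zero    = trans (zero-zero A) (sym (zero-zero B))
  PowerCoefficients-unique A B zero    (suc n) = trans (zero-suc A n) (sym (zero-suc B n))
  PowerCoefficients-unique A B (suc m) zero    = trans (suc-zero A m) (sym (suc-zero B m))
  PowerCoefficients-unique {l} {c} {a} {b} A B (suc m) (suc n) =
    +-cancelʳ (l * fromℕ n * a (suc m) n) _ _ (begin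
      a (suc m) (suc n) + l * fromℕ n * a (suc m) n ≈⟨ suc-suc A m n ⟩
      fromℕ (suc m) * (a m n + c * a (suc m) n)     ≈⟨ *-congˡ (+-cong (ih m) (*-congˡ (ih (suc m)))) ⟩
      fromℕ (suc m) * (b m n + c * b (suc m) n)     ≈⟨ suc-suc B m n ⟨
      b (suc m) (suc n) + l * fromℕ n * b (suc m) n ≈⟨ +-congˡ (*-congˡ (ih (suc m))) ⟨
      b (suc m) (suc n) + l * fromℕ n * a (suc m) n ∎)
    where
    ih : ∀ m → a m n ≈ b m n
    ih m = PowerCoefficients-unique A B m n

  -- For l = 0 the correction term disappears, and the recurrence reduces an entry with n < m to two
  -- entries of the same kind. For the powers of eᵗ - 1 this is the vanishing of S₂(n,m) for n < m.
  PowerCoefficients-zero : ∀ {c a} → PowerCoefficients 0# c a → ∀ {m n} → n < m → a m n ≈ 0#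
  PowerCoefficients-zero A {suc m} {zero} _ = suc-zero A m
  PowerCoefficients-zero {c} {a} A {suc m} {suc n} (s<s n<m) = begin
    a (suc m) (suc n)                               ≈⟨ +-identityʳ _ ⟨
    a (suc m) (suc n) + 0#                          ≈⟨ +-congˡ (trans (*-congʳ (zeroˡ _)) (zeroˡ _)) ⟨
    a (suc m) (suc n) + 0# * fromℕ n * a (suc m) n  ≈⟨ suc-suc A m n ⟩
    fromℕ (suc m) * (a m n + c * a (suc m) n)
      ≈⟨ *-congˡ (+-cong (PowerCoefficients-zero A n<m)
           (trans (*-congˡ (PowerCoefficients-zero A (m<n⇒m<1+n n<m))) (zeroʳ c))) ⟩
    fromℕ (suc m) * (0# + 0#)                       ≈⟨ *-congˡ (+-identityˡ 0#) ⟩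
    fromℕ (suc m) * 0#                              ≈⟨ zeroʳ _ ⟩
    0#                                              ∎

  ^ˢ-PowerCoefficients : ∀ {l c g} → g 0 ≈ 0# → ∂ l g S.≈ (S.1# S.+ (c • g)) →
                         PowerCoefficients l c (λ m → egfCoeff (g ^ˢ m))
  ^ˢ-PowerCoefficients {l} {c} {g} g₀≈0 ∂g = record
    { zero-zero = trans (*-identityʳ _) (+-identityʳ 1#)
    ; zero-suc  = λ n → zeroʳ _
    ; suc-zero  = λ m → trans (*-congˡ (trans (+-identityʳ _) (trans (*-congʳ g₀≈0) (zeroˡ _)))) (zeroʳ _)
    ; suc-suc   = λ m n → begin
        egfCoeff (g ^ˢ suc m) (suc n) + l * fromℕ n * egfCoeff (g ^ˢ suc m) n
          ≈⟨ egfCoeff-∂ l (g ^ˢ suc m) n ⟩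
        fromℕ (n !) * ∂ l (g ^ˢ suc m) n
          ≈⟨ *-congˡ (∂-^ˢ ∂g m n) ⟩
        fromℕ (n !) * (fromℕ (suc m) * ((g ^ˢ m) n + c * (g ^ˢ suc m) n))
          ≈⟨ solve 5 (λ F s x c y → F :* (s :* (x :+ (c :* y))) := s :* ((F :* x) :+ (c :* (F :* y)))) refl
               (fromℕ (n !)) (fromℕ (suc m)) ((g ^ˢ m) n) c ((g ^ˢ suc m) n) ⟩
        fromℕ (suc m) * (egfCoeff (g ^ˢ m) n + c * egfCoeff (g ^ˢ suc m) n) ∎
    }

  -- The differential equations of eᵗ - 1 and 1 - (1 + l t)^(-1/l)

  D-egf : ∀ a n → D (egf a) n ≈ egf (a ∘ suc) n
  D-egf a n = trans
    (solve 3 (λ s x i → s :* (x :* i) := x :* (s :* i)) refl (fromℕ (suc n)) (a (suc n)) (inv! (suc n)))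
    (*-congˡ (inv!-suc n))

  -- The exponential is its own derivative; inserting `S.1# n + - S.1# n` rewrites it as 1 + (eᵗ -
  -- 1).
  ∂-exp-1 : ∂ 0# (exp S.+ (S.- S.1#)) S.≈ (S.1# S.+ (1# • (exp S.+ (S.- S.1#))))
  ∂-exp-1 n = begin
    ∂ 0# (exp S.+ (S.- S.1#)) n
      ≈⟨ ∂-difference 0# exp S.1# n ⟩
    (D exp n + 0# * θ exp n) + - ∂ 0# S.1# n
      ≈⟨ +-cong (+-cong (D-egf (λ _ → 1#) n) (zeroˡ _)) (trans (-‿cong (∂-1 0# n)) -0#≈0#) ⟩
    (exp n + 0#) + 0#
      ≈⟨ +-congˡ (-‿inverseʳ (S.1# n)) ⟨
    (exp n + 0#) + (S.1# n + - S.1# n)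
      ≈⟨ +-congʳ (+-identityʳ _) ⟩
    exp n + (S.1# n + - S.1# n)
      ≈⟨ solve 3 (λ x y z → x :+ (y :+ z) := y :+ (x :+ z)) refl (exp n) (S.1# n) (- S.1# n) ⟩
    S.1# n + (exp n + - S.1# n)
      ≈⟨ +-congˡ (*-identityˡ _) ⟨
    S.1# n + 1# * (exp n + - S.1# n) ∎

  egfCoeff-exp-1-^ˢ : PowerCoefficients 0# 1# (λ m → egfCoeff ((exp S.+ (S.- S.1#)) ^ˢ m))
  egfCoeff-exp-1-^ˢ = ^ˢ-PowerCoefficients
    (trans (+-congʳ (trans (*-identityˡ _) inv!-zero)) (-‿inverseʳ 1#))
    ∂-exp-1

  -- Differentiation brings in the next factor (a - n) l of the coefficient, the summand `l • θ`
  -- adds n l, and a l remains.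
  ∂-binomialSeries : ∀ l a → ∂ l (binomialSeries l a) S.≈ ((a * l) • binomialSeries l a)
  ∂-binomialSeries l a n = begin
    D (egf b) n + l * (N * (f * p * i))
      ≈⟨ +-congʳ (D-egf b n) ⟩
    f * (a + - N) * (l * p) * i + l * (N * (f * p * i))
      ≈⟨ solve 7 (λ f a y l p i N →
           (((f :* (a :+ y)) :* (l :* p)) :* i) :+ (l :* (N :* ((f :* p) :* i)))
             := ((a :* l) :* ((f :* p) :* i)) :+ ((l :* ((f :* p) :* i)) :* (y :+ N))) refl
           f a (- N) l p i N ⟩
    a * l * (f * p * i) + l * (f * p * i) * (- N + N)
      ≈⟨ +-congˡ (trans (*-congˡ (-‿inverseˡ N)) (zeroʳ _)) ⟩
    a * l * (f * p * i) + 0#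
      ≈⟨ +-identityʳ _ ⟩
    a * l * (f * p * i) ∎
    where
    b : ℕ → Carrier
    b j = falling a j * l ^ j
    f = falling a n
    p = l ^ n
    i = inv! n
    N = fromℕ n

  -- The exponent -1/l makes the factor a l equal to -1, so B = (1 + l t)^(-1/l) is sent to -B, and
  -- 1 - B to B = 1 - (1 - B).
  ∂-argument : ∀ l (l#0 : l # 0#) →
               ∂ l (argument l l#0) S.≈ (S.1# S.+ ((- 1#) • argument l l#0))
  ∂-argument l l#0 n = begin
    ∂ l (argument l l#0) n
      ≈⟨ ∂-difference l S.1# B n ⟩
    ∂ l S.1# n + - ∂ l B n
      ≈⟨ +-cong (∂-1 l n) (-‿cong (∂-binomialSeries l (- inv l#0) n)) ⟩
    0# + - (- inv l#0 * l * B n)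
      ≈⟨ +-cong (-‿inverseʳ (S.1# n))
           (-‿cong (trans (sym (-1*x≈-x (B n))) (*-congʳ (sym -inv*l≈-1)))) ⟨
    (S.1# n + - S.1# n) + - - B n
      ≈⟨ +-assoc _ _ _ ⟩
    S.1# n + (- S.1# n + - - B n)
      ≈⟨ +-congˡ (-‿+-comm (S.1# n) (- B n)) ⟩
    S.1# n + - (S.1# n + - B n)
      ≈⟨ +-congˡ (-1*x≈-x _) ⟨
    S.1# n + (- 1#) * (S.1# n + - B n) ∎
    where
    B = binomialSeries l (- inv l#0)

    -inv*l≈-1 : - inv l#0 * l ≈ - 1#
    -inv*l≈-1 = begin
      - inv l#0 * l   ≈⟨ -‿distribˡ-* (inv l#0) l ⟨
      - (inv l#0 * l) ≈⟨ -‿cong (trans (*-comm _ _) (inv-inverseʳ l#0)) ⟩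
      - 1#            ∎

  egfCoeff-argument-^ˢ : ∀ l (l#0 : l # 0#) →
                         PowerCoefficients l (- 1#) (λ m → egfCoeff (argument l l#0 ^ˢ m))
  egfCoeff-argument-^ˢ l l#0 =
    ^ˢ-PowerCoefficients (argument-constantTerm l l#0) (∂-argument l l#0)

  -- Stirling numbers

  -- With `-fromℕˢ-suc`, this identifies the subtrahend of the factor X - n as a constant series,
  -- the form that `*ˢ-constantʳ` expects.
  -fromℕˢ-zero : ∀ n → (S.- (n ×ˢ S.1#)) 0 ≈ - fromℕ n
  -fromℕˢ-zero n = -‿cong (lemma n)
    where
    lemma : ∀ n → (n ×ˢ S.1#) 0 ≈ fromℕ n
    lemma zero    = refl
    lemma (suc n) = +-congˡ (lemma n)

  -fromℕˢ-suc : ∀ n j → (S.- (n ×ˢ S.1#)) (suc j) ≈ 0#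
  -fromℕˢ-suc n j = trans (-‿cong (lemma n)) -0#≈0#
    where
    lemma : ∀ n → (n ×ˢ S.1#) (suc j) ≈ 0#
    lemma zero    = refl
    lemma (suc n) = trans (+-identityˡ _) (lemma n)

  -- Distributing over the factor X - n, the constant part cancels against `fromℕ n * S₁ n j`. Both
  -- recurrences of `S₁` are read off from this.
  S₁-step : ∀ n j → S₁ (suc n) j + fromℕ n * S₁ n j ≈ (fallingˢ X n S.* X) j
  S₁-step n j = begin
    (F S.* (X S.+ C)) j + N * F j
      ≈⟨ +-congʳ (*ˢ-distribˡ-+ F X C j) ⟩
    ((F S.* X) j + (F S.* C) j) + N * F j
      ≈⟨ +-congʳ (+-congˡ (trans (*ˢ-constantʳ F C (-fromℕˢ-suc n) j) (*-congˡ (-fromℕˢ-zero n)))) ⟩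
    ((F S.* X) j + F j * - N) + N * F j
      ≈⟨ solve 4 (λ x f y N → (x :+ (f :* y)) :+ (N :* f) := x :+ (f :* (y :+ N))) refl
           ((F S.* X) j) (F j) (- N) N ⟩
    (F S.* X) j + F j * (- N + N)
      ≈⟨ +-congˡ (trans (*-congˡ (-‿inverseˡ N)) (zeroʳ (F j))) ⟩
    (F S.* X) j + 0#
      ≈⟨ +-identityʳ _ ⟩
    (F S.* X) j ∎
    where
    F = fallingˢ X n
    C = S.- (n ×ˢ S.1#)
    N = fromℕ n

  S₁-suc-suc : ∀ n j → S₁ (suc n) (suc j) + fromℕ n * S₁ n (suc j) ≈ S₁ n j
  S₁-suc-suc n j = trans (S₁-step n (suc j)) (*ˢ-X-suc (fallingˢ X n) j)

  S₁-suc-zero : ∀ n → S₁ (suc n) 0 + fromℕ n * S₁ n 0 ≈ 0#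
  S₁-suc-zero n = trans (S₁-step n 0) (trans (+-identityʳ _) (zeroʳ _))

  S₁-zero : ∀ {n j} → n < j → S₁ n j ≈ 0#
  S₁-zero {zero}  {suc j} _         = refl
  S₁-zero {suc n} {suc j} (s<s n<j) = begin
    S₁ (suc n) (suc j)
      ≈⟨ +-identityʳ _ ⟨
    S₁ (suc n) (suc j) + 0#
      ≈⟨ +-congˡ (trans (*-congˡ (S₁-zero (m<n⇒m<1+n n<j))) (zeroʳ _)) ⟨
    S₁ (suc n) (suc j) + fromℕ n * S₁ n (suc j)
      ≈⟨ S₁-suc-suc n j ⟩
    S₁ n j
      ≈⟨ S₁-zero n<j ⟩
    0# ∎

  -- The 1/m! in the definition of `S₂` cancels, which links the Stirling numbers to the array
  -- governed by `PowerCoefficients`.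
  m!*S₂ : ∀ n m → fromℕ (m !) * S₂ n m ≈ egfCoeff ((exp S.+ (S.- S.1#)) ^ˢ m) n
  m!*S₂ n m = begin
    M * (N * (i * x)) ≈⟨ solve 4 (λ M N i x → M :* (N :* (i :* x)) := (M :* i) :* (N :* x)) refl M N i x ⟩
    M * i * (N * x)   ≈⟨ *-congʳ (inv!-inverseʳ m) ⟩
    1# * (N * x)      ≈⟨ *-identityˡ _ ⟩
    N * x             ∎
    where
    M = fromℕ (m !)
    N = fromℕ (n !)
    i = inv! m
    x = ((exp S.+ (S.- S.1#)) ^ˢ m) n

  -- The coefficients of the polynomial x (x - l) ⋯ (x - (n - 1) l); for j > n the
  -- truncated exponent is harmless since then S₁ n j vanishes.
  degenerateS₁ : Carrier → ℕ → ℕ → Carrier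
  degenerateS₁ l n j = S₁ n j * l ^ (n ∸ j)

  degenerateS₁-zero : ∀ l {n j} → n < j → degenerateS₁ l n j ≈ 0#
  degenerateS₁-zero l n<j = trans (*-congʳ (S₁-zero n<j)) (zeroˡ _)

  degenerateS₁-suc-zero : ∀ l n → degenerateS₁ l (suc n) 0 + l * fromℕ n * degenerateS₁ l n 0 ≈ 0#
  degenerateS₁-suc-zero l n = begin
    s * (l * p) + l * N * (t * p)
      ≈⟨ solve 5 (λ s l p N t → (s :* (l :* p)) :+ ((l :* N) :* (t :* p)) := (s :+ (N :* t)) :* (l :* p)) refl
           s l p N t ⟩
    (s + N * t) * (l * p)
      ≈⟨ *-congʳ (S₁-suc-zero n) ⟩
    0# * (l * p)
      ≈⟨ zeroˡ _ ⟩
    0# ∎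
    where
    s = S₁ (suc n) 0
    t = S₁ n 0
    p = l ^ n
    N = fromℕ n

  degenerateS₁-suc-suc : ∀ l n j → degenerateS₁ l (suc n) (suc j) + l * fromℕ n * degenerateS₁ l n (suc j)
                                   ≈ degenerateS₁ l n j
  degenerateS₁-suc-suc l n j = begin
    s * l ^ (n ∸ j) + l * N * (t * l ^ (n ∸ suc j))
      ≈⟨ +-congˡ power ⟩
    s * l ^ (n ∸ j) + N * t * l ^ (n ∸ j)
      ≈⟨ distribʳ _ _ _ ⟨
    (s + N * t) * l ^ (n ∸ j)
      ≈⟨ *-congʳ (S₁-suc-suc n j) ⟩
    S₁ n j * l ^ (n ∸ j) ∎
    where
    s = S₁ (suc n) (suc j)
    t = S₁ n (suc j)
    N = fromℕ n

    -- For j < n the additional factor `l` makes up for the smaller exponent. For j ≥ n both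
    -- exponents truncate to 0, but then S₁(n,j+1) = 0 and both sides vanish.
    power : l * N * (t * l ^ (n ∸ suc j)) ≈ N * t * l ^ (n ∸ j)
    power with j <? n
    ... | yes j<n = begin
      l * N * (t * p)
        ≈⟨ solve 4 (λ l N t p → (l :* N) :* (t :* p) := (N :* t) :* (l :* p)) refl l N t p ⟩
      N * t * l ^ suc (n ∸ suc j)
        ≡⟨ ≡.cong (λ k → N * t * l ^ k) (ℕ.+-∸-assoc 1 j<n) ⟨
      N * t * l ^ (n ∸ j) ∎
      where p = l ^ (n ∸ suc j)
    ... | no j≮n = begin
      l * N * (t * l ^ (n ∸ suc j)) ≈⟨ *-congˡ (trans (*-congʳ t≈0) (zeroˡ _)) ⟩
      l * N * 0#                    ≈⟨ zeroʳ _ ⟩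
      0#                            ≈⟨ trans (*-congʳ (trans (*-congˡ t≈0) (zeroʳ N))) (zeroˡ _) ⟨
      N * t * l ^ (n ∸ j)           ∎
      where
      t≈0 : t ≈ 0#
      t≈0 = S₁-zero (s≤s (≮⇒≥ j≮n))

  -- If Σⱼ aⱼ xʲ/j! is a series in x, substituting x = log(1 + l t)/l
  -- gives Σₙ (logTransform l a n) tⁿ/n!.
  logTransform : Carrier → (ℕ → Carrier) → ℕ → Carrier
  logTransform l a n = ∑[ j ≤ n ] (a (toℕ j) * degenerateS₁ l n (toℕ j))

  logTransform-cong : ∀ l {a b} → (∀ j → a j ≈ b j) → ∀ n → logTransform l a n ≈ logTransform l b n
  logTransform-cong l a≈b n = sum-cong-≋ {suc n} (λ j → *-congʳ {degenerateS₁ l n (toℕ j)} (a≈b (toℕ j)))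

  logTransform-zero : ∀ l {a} → (∀ j → a j ≈ 0#) → ∀ n → logTransform l a n ≈ 0#
  logTransform-zero l {a} a≈0 n =
    sum-zero {suc n} {λ j → a j * degenerateS₁ l n j} (λ j → trans (*-congʳ (a≈0 j)) (zeroˡ _))

  -- Linearity, in the shape of the right-hand side of `suc-suc`.
  logTransform-linear : ∀ l x y a b n →
    logTransform l (λ j → x * (a j + y * b j)) n ≈ x * (logTransform l a n + y * logTransform l b n)
  logTransform-linear l x y a b n = begin
    ∑[ j ≤ n ] (x * (a (toℕ j) + y * b (toℕ j)) * w (toℕ j))
      ≈⟨ sum-cong-≋ {suc n} (λ j →
           solve 5 (λ x a y b w → (x :* (a :+ (y :* b))) :* w := x :* ((a :* w) :+ (y :* (b :* w)))) refl
             x (a (toℕ j)) y (b (toℕ j)) (w (toℕ j))) ⟩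
    ∑[ j ≤ n ] (x * (a (toℕ j) * w (toℕ j) + y * (b (toℕ j) * w (toℕ j))))
      ≈⟨ *-distribˡ-sum {suc n} x (λ j → a (toℕ j) * w (toℕ j) + y * (b (toℕ j) * w (toℕ j))) ⟨
    x * ∑[ j ≤ n ] (a (toℕ j) * w (toℕ j) + y * (b (toℕ j) * w (toℕ j)))
      ≈⟨ *-congˡ (∑-distrib-+ {suc n} (λ j → a (toℕ j) * w (toℕ j)) (λ j → y * (b (toℕ j) * w (toℕ j)))) ⟩
    x * (logTransform l a n + ∑[ j ≤ n ] (y * (b (toℕ j) * w (toℕ j))))
      ≈⟨ *-congˡ (+-congˡ (*-distribˡ-sum {suc n} y (λ j → b (toℕ j) * w (toℕ j)))) ⟨
    x * (logTransform l a n + y * logTransform l b n) ∎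
    where
    w = degenerateS₁ l n

  -- The chain rule on coefficients: (1 + l t) d/dt sends log(1 + l t)/l to 1, so after the
  -- substitution it acts as d/dx did before it, and d/dx shifts `a`.
  logTransform-suc : ∀ l a n →
    logTransform l a (suc n) + l * fromℕ n * logTransform l a n ≈ logTransform l (a ∘ suc) n
  logTransform-suc l a n = begin
    logTransform l a (suc n) + x * logTransform l a n
      -- A vanishing summand at j = n + 1 gives both sums the same range; after splitting off j = 0
      -- they combine term by term.
      ≈⟨ +-congˡ (*-congˡ (sum-extend (ℕ.n≤1+n n)
           (λ j n<j → trans (*-congˡ (degenerateS₁-zero l n<j)) (zeroʳ (a j))))) ⟩
    (a 0 * w′ 0 + P) + x * (a 0 * w 0 + Q)
      ≈⟨ solve 6 (λ a w′ P x w Q →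
           ((a :* w′) :+ P) :+ (x :* ((a :* w) :+ Q)) := (a :* (w′ :+ (x :* w))) :+ (P :+ (x :* Q))) refl
           (a 0) (w′ 0) P x (w 0) Q ⟩
    a 0 * (w′ 0 + x * w 0) + (P + x * Q)
      ≈⟨ +-congʳ (trans (*-congˡ (degenerateS₁-suc-zero l n)) (zeroʳ (a 0))) ⟩
    0# + (P + x * Q)
      ≈⟨ +-identityˡ _ ⟩
    P + x * Q
      ≈⟨ +-congˡ (*-distribˡ-sum {suc n} x (λ j → q (toℕ j))) ⟩
    P + ∑[ j ≤ n ] (x * q (toℕ j))
      ≈⟨ ∑-distrib-+ {suc n} (λ j → p (toℕ j)) (λ j → x * q (toℕ j)) ⟨
    ∑[ j ≤ n ] (p (toℕ j) + x * q (toℕ j))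
      ≈⟨ sum-cong-≋ {suc n} (λ j → term (toℕ j)) ⟩
    logTransform l (a ∘ suc) n ∎
    where
    x  = l * fromℕ n
    w  = degenerateS₁ l n
    w′ = degenerateS₁ l (suc n)

    p q : ℕ → Carrier
    p j = a (suc j) * w′ (suc j)
    q j = a (suc j) * w (suc j)
    P   = ∑[ j ≤ n ] p (toℕ j)
    Q   = ∑[ j ≤ n ] q (toℕ j)

    term : ∀ j → p j + x * q j ≈ a (suc j) * w j
    term j = trans
      (solve 4 (λ a w′ x w → (a :* w′) :+ (x :* (a :* w)) := a :* (w′ :+ (x :* w))) refl
        (a (suc j)) (w′ (suc j)) x (w (suc j)))
      (*-congˡ (degenerateS₁-suc-suc l n j))

  -- The sign joins two effects: (-1)ʲ replaces x by -x before the logarithm is substituted, and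
  -- (-1)ᵐ turns powers of (1 + l t)^(-1/l) - 1 into powers of its negative.
  logTransform-PowerCoefficients : ∀ l {a} → PowerCoefficients 0# 1# a →
    PowerCoefficients l (- 1#) (λ m → logTransform l (λ j → (- 1#) ^ (m ℕ.+ j) * a m j))
  logTransform-PowerCoefficients l {a} A = record
    { zero-zero = begin
        1# * a 0 0 * (1# * 1#) + 0# ≈⟨ +-identityʳ _ ⟩
        1# * a 0 0 * (1# * 1#)      ≈⟨ *-cong (*-identityˡ _) (*-identityˡ 1#) ⟩
        a 0 0 * 1#                  ≈⟨ *-identityʳ _ ⟩
        a 0 0                       ≈⟨ zero-zero A ⟩
        1#                          ∎
    ; zero-suc  = b-zero-suc
    ; suc-zero  = λ m → trans (+-identityʳ _)
        (trans (*-congʳ (trans (*-congˡ (suc-zero A m)) (zeroʳ _))) (zeroˡ _))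
    ; suc-suc   = λ m n → begin
        logTransform l (b (suc m)) (suc n) + l * fromℕ n * logTransform l (b (suc m)) n
          ≈⟨ logTransform-suc l (b (suc m)) n ⟩
        logTransform l (b (suc m) ∘ suc) n
          ≈⟨ logTransform-cong l {b (suc m) ∘ suc} (b-suc-suc m) n ⟩
        logTransform l (λ j → fromℕ (suc m) * (b m j + - 1# * b (suc m) j)) n
          ≈⟨ logTransform-linear l (fromℕ (suc m)) (- 1#) (b m) (b (suc m)) n ⟩
        fromℕ (suc m) * (logTransform l (b m) n + - 1# * logTransform l (b (suc m)) n) ∎
    }
    where
    b : ℕ → ℕ → Carrier
    b m j = (- 1#) ^ (m ℕ.+ j) * a m j

    -- `b 0` vanishes beyond index 0, so its shift transforms to zero. The correction term vanishes
    -- for n = 0 through its factor n, and otherwise by induction.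
    b-zero-suc : ∀ n → logTransform l (b 0) (suc n) ≈ 0#
    b-zero-suc n = begin
      logTransform l (b 0) (suc n)
        ≈⟨ +-identityʳ _ ⟨
      logTransform l (b 0) (suc n) + 0#
        ≈⟨ +-congˡ (correction n) ⟨
      logTransform l (b 0) (suc n) + l * fromℕ n * logTransform l (b 0) n
        ≈⟨ logTransform-suc l (b 0) n ⟩
      logTransform l (b 0 ∘ suc) n
        ≈⟨ logTransform-zero l (λ j → trans (*-congˡ {(- 1#) ^ suc j} (zero-suc A j)) (zeroʳ _)) n ⟩
      0# ∎
      where
      correction : ∀ n → l * fromℕ n * logTransform l (b 0) n ≈ 0#
      correction zero    = trans (*-congʳ (zeroʳ l)) (zeroˡ _)
      correction (suc n) = trans (*-congˡ (b-zero-suc n)) (zeroʳ _)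

    -1*-1≈1 : - 1# * - 1# ≈ 1#
    -1*-1≈1 = trans (-1*x≈-x (- 1#)) (-‿involutive 1#)

    a-suc-suc : ∀ m j → a (suc m) (suc j) ≈ fromℕ (suc m) * (a m j + a (suc m) j)
    a-suc-suc m j = begin
      a (suc m) (suc j)                              ≈⟨ +-identityʳ _ ⟨
      a (suc m) (suc j) + 0#                         ≈⟨ +-congˡ (trans (*-congʳ (zeroˡ _)) (zeroˡ _)) ⟨
      a (suc m) (suc j) + 0# * fromℕ j * a (suc m) j ≈⟨ suc-suc A m j ⟩
      fromℕ (suc m) * (a m j + 1# * a (suc m) j)     ≈⟨ *-congˡ (+-congˡ (*-identityˡ _)) ⟩
      fromℕ (suc m) * (a m j + a (suc m) j)          ∎

    -- Compared with the left-hand side, the exponent of -1 is smaller by two at (m , j) and by one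
    -- at (m + 1 , j). Only the latter term changes sign, which turns c = 1 into c = -1.
    b-suc-suc : ∀ m j → b (suc m) (suc j) ≈ fromℕ (suc m) * (b m j + - 1# * b (suc m) j)
    b-suc-suc m j = begin
      e * e ^ (m ℕ.+ suc j) * a (suc m) (suc j)
        ≡⟨ ≡.cong (λ k → e * e ^ k * a (suc m) (suc j)) (+-suc m j) ⟩
      e * (e * p) * a (suc m) (suc j)
        ≈⟨ *-congˡ (a-suc-suc m j) ⟩
      e * (e * p) * (s * (x + y))
        ≈⟨ solve 5 (λ e p s x y →
             (e :* (e :* p)) :* (s :* (x :+ y))
               := s :* (((e :* e) :* (p :* x)) :+ (e :* ((e :* p) :* y)))) refl e p s x y ⟩
      s * (e * e * (p * x) + e * (e * p * y))
        ≈⟨ *-congˡ (+-congʳ (trans (*-congʳ -1*-1≈1) (*-identityˡ _))) ⟩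
      s * (p * x + e * (e * p * y)) ∎
      where
      e = - 1#
      p = e ^ (m ℕ.+ j)
      s = fromℕ (suc m)
      x = a m j
      y = a (suc m) j

  -- The formula for the fully degenerate poly-Bernoulli numbers

  egfCoeff-argument-^ˢ-Stirling : ∀ l (l#0 : l # 0#) m n →
    egfCoeff (argument l l#0 ^ˢ m) n
      ≈ logTransform l (λ j → (- 1#) ^ (m ℕ.+ j) * egfCoeff ((exp S.+ (S.- S.1#)) ^ˢ m) j) n
  egfCoeff-argument-^ˢ-Stirling l l#0 = PowerCoefficients-unique
    (egfCoeff-argument-^ˢ l l#0)
    (logTransform-PowerCoefficients l egfCoeff-exp-1-^ˢ)

  β-Stirling : ∀ k n l (l#0 : l # 0#) →
    β l l#0 k n ≈
      ∑[ j ≤ n ] ∑[ m ≤ toℕ j ]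
        ((- 1#) ^ (toℕ m ℕ.+ toℕ j) * fromℕ (toℕ m !) * recipPow (toℕ m) k
          * S₂ (toℕ j) (toℕ m) * S₁ n (toℕ j) * l ^ (n ∸ toℕ j))
  β-Stirling k n l l#0 = begin
    fromℕ (n !) * ∑[ m ≤ n ] (recipPow (toℕ m) k * (A ^ˢ toℕ m) n)
      ≈⟨ *-distribˡ-sum {suc n} (fromℕ (n !)) (λ m → recipPow (toℕ m) k * (A ^ˢ toℕ m) n) ⟩
    ∑[ m ≤ n ] (fromℕ (n !) * (recipPow (toℕ m) k * (A ^ˢ toℕ m) n))
      ≈⟨ sum-cong-≋ {suc n} (λ m → expand (toℕ m)) ⟩
    ∑[ m ≤ n ] ∑[ j ≤ n ] term (toℕ m) (toℕ j)
      ≈⟨ ∑-comm {suc n} {suc n} (λ m j → term (toℕ m) (toℕ j)) ⟩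
    ∑[ j ≤ n ] ∑[ m ≤ n ] term (toℕ m) (toℕ j)
      -- The composition truncates at m = n for every j; the summands with j < m vanish, so the
      -- inner range shrinks to m ≤ j.
      ≈⟨ sum-cong-≋ {suc n} (λ j → sum-extend (toℕ≤pred[n] j) (λ m → term-zero m (toℕ j))) ⟨
    ∑[ j ≤ n ] ∑[ m ≤ toℕ j ] term (toℕ m) (toℕ j) ∎
    where
    A = argument l l#0

    G : ℕ → ℕ → Carrier
    G m = egfCoeff ((exp S.+ (S.- S.1#)) ^ˢ m)

    term : ℕ → ℕ → Carrier
    term m j = (- 1#) ^ (m ℕ.+ j) * fromℕ (m !) * recipPow m k * S₂ j m * S₁ n j * l ^ (n ∸ j)

    term-G : ∀ m j → recipPow m k * ((- 1#) ^ (m ℕ.+ j) * G m j * degenerateS₁ l n j) ≈ term m j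
    term-G m j = begin
      r * (e * G m j * (s * p))
        ≈⟨ *-congˡ (*-congʳ (*-congˡ (m!*S₂ j m))) ⟨
      r * (e * (F * t) * (s * p))
        ≈⟨ solve 6 (λ r e F t s p →
             r :* ((e :* (F :* t)) :* (s :* p)) := ((((e :* F) :* r) :* t) :* s) :* p) refl r e F t s p ⟩
      e * F * r * t * s * p ∎
      where
      r = recipPow m k
      e = (- 1#) ^ (m ℕ.+ j)
      F = fromℕ (m !)
      t = S₂ j m
      s = S₁ n j
      p = l ^ (n ∸ j)

    -- The vanishing is available for `G m j` rather than for `S₂ j m`, hence the detour through
    -- `term-G`.
    term-zero : ∀ m j → j < m → term m j ≈ 0#
    term-zero m j j<m = begin
      term m j
        ≈⟨ term-G m j ⟨
      recipPow m k * ((- 1#) ^ (m ℕ.+ j) * G m j * degenerateS₁ l n j)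
        ≈⟨ *-congˡ (*-congʳ (*-congˡ (PowerCoefficients-zero egfCoeff-exp-1-^ˢ j<m))) ⟩
      recipPow m k * ((- 1#) ^ (m ℕ.+ j) * 0# * degenerateS₁ l n j)
        ≈⟨ *-congˡ (trans (*-congʳ (zeroʳ _)) (zeroˡ _)) ⟩
      recipPow m k * 0#
        ≈⟨ zeroʳ _ ⟩
      0# ∎

    expand : ∀ m → fromℕ (n !) * (recipPow m k * (A ^ˢ m) n) ≈ ∑[ j ≤ n ] term m (toℕ j)
    expand m = begin
      fromℕ (n !) * (recipPow m k * (A ^ˢ m) n)
        ≈⟨ solve 3 (λ x y z → x :* (y :* z) := y :* (x :* z)) refl (fromℕ (n !)) (recipPow m k) ((A ^ˢ m) n) ⟩
      recipPow m k * egfCoeff (A ^ˢ m) n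
        ≈⟨ *-congˡ (egfCoeff-argument-^ˢ-Stirling l l#0 m n) ⟩
      recipPow m k * logTransform l (λ j → (- 1#) ^ (m ℕ.+ j) * G m j) n
        ≈⟨ *-distribˡ-sum {suc n} (recipPow m k)
             (λ j → (- 1#) ^ (m ℕ.+ toℕ j) * G m (toℕ j) * degenerateS₁ l n (toℕ j)) ⟩
      ∑[ j ≤ n ] (recipPow m k * ((- 1#) ^ (m ℕ.+ toℕ j) * G m (toℕ j) * degenerateS₁ l n (toℕ j)))
        ≈⟨ sum-cong-≋ {suc n} (λ j → term-G m (toℕ j)) ⟩
      ∑[ j ≤ n ] term m (toℕ j) ∎

theorem4 : ∀ {c ℓ₁ ℓ₂} (K : HeytingField c ℓ₁ ℓ₂) (char0 : CharacteristicZero K) →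
  let open HeytingField K
      open PolyBernoulli K char0
  in (k : ℤ) (n : ℕ) (λ′ : Carrier) (λ′#0 : λ′ # 0#) →
     β λ′ λ′#0 k n ≈
       ∑[ l ≤ n ] ∑[ m ≤ toℕ l ]
         ((- 1#) ^ (toℕ m ℕ.+ toℕ l) * fromℕ (toℕ m !) * recipPow (toℕ m) k
           * S₂ (toℕ l) (toℕ m) * S₁ n (toℕ l) * λ′ ^ (n ∸ toℕ l))
theorem4 K char0 = DegeneratePowers.β-Stirling K char0
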